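{- There exists $n_0$ such that for all $n\ge n_0$, $\operatorname{op}_{n,4}(123) > \operatorname{op}_{n,3}(123)$.
   Context: An ordered set partition of $[n]$ into $k$ blocks is a sequence $B_1/B_2/\cdots/B_k$ of nonempty, pairwise disjoint subsets of $[n]$ whose union is $[n]$; the order of the blocks matters, but not the order of elements within a block. Such a partition contains the pattern $123$ if there are block indices $i_1<i_2<i_3$ and elements $b_j\in B_{i_j}$ with $b_1<b_2<b_3$; otherwise it avoids $123$. $\operatorname{op}_{n,k}(123)$ is the number of $123$-avoiding ordered partitions of $[n]$ into $k$ blocks. -}

module Defs where

open import Data.Bool.Base using (true; false)
open import Data.Fin.Base using (Fin; _<_)
open import Data.Fin.Properties using (_≟_; _<?_; any?; all?)
open import Data.Fin.Subset using (Subset; _∈_; _∩_; ⋃; ⊤; Nonempty; Empty; inside; outside)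
open import Data.Fin.Subset.Properties using (_∈?_; nonempty?)
open import Data.List.Base using (List; []; _∷_; length; filter; cartesianProductWith)
open import Data.List.Membership.Propositional using () renaming (_∈_ to _∈ˡ_)
open import Data.List.Membership.Propositional.Properties using (∈-cartesianProductWith⁺; ∈-filter⁺; ∈-filter⁻)
open import Data.List.Relation.Unary.All using ([]; _∷_)
open import Data.List.Relation.Unary.AllPairs using ([]; _∷_)
open import Data.List.Relation.Unary.Any using (here; there)
open import Data.List.Relation.Unary.Unique.Propositional using (Unique)
import Data.List.Relation.Unary.Unique.Propositional.Properties as Unique
open import Data.Nat.Base using (ℕ; zero; suc)
open import Data.Product.Base using (∃-syntax; _×_; _,_; proj₂)
open import Data.Vec.Base using (Vec; []; _∷_; lookup; toList)
open import Data.Vec.Properties using (∷-injective; ≡-dec)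
import Data.Bool.Properties as Bool
open import Function.Bundles using (_⇔_; mk⇔)
open import Relation.Binary.PropositionalEquality using (_≡_; _≢_; refl)
open import Relation.Nullary.Decidable using (Dec; ¬?; map′; _×-dec_; _→-dec_)
open import Relation.Nullary.Negation using (¬_)

-- The ground set [n] = {1,…,n} is represented by the ordered set Fin n, and a
-- sequence B₁/…/B_k by a vector of subsets of it.

record IsOrderedPartition {n k : ℕ} (B : Vec (Subset n) k) : Set where
  constructor isOrderedPartition
  field
    nonempty : ∀ i → Nonempty (lookup B i)
    disjoint : ∀ i j → i ≢ j → Empty (lookup B i ∩ lookup B j)
    covering : ⋃ (toList B) ≡ ⊤

Contains123 : {n k : ℕ} → Vec (Subset n) k → Set
Contains123 B =
  ∃[ i₁ ] ∃[ i₂ ] ∃[ i₃ ] (i₁ < i₂ × i₂ < i₃ ×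
    (∃[ b₁ ] ∃[ b₂ ] ∃[ b₃ ]
      (b₁ ∈ lookup B i₁ × b₂ ∈ lookup B i₂ × b₃ ∈ lookup B i₃ ×
       b₁ < b₂ × b₂ < b₃)))

Avoids123 : {n k : ℕ} → Vec (Subset n) k → Set
Avoids123 B = ¬ Contains123 B

isOrderedPartition? : {n k : ℕ} (B : Vec (Subset n) k) → Dec (IsOrderedPartition B)
isOrderedPartition? B =
  map′ (λ (p , q , r) → isOrderedPartition p q r)
       (λ (isOrderedPartition p q r) → p , q , r)
       (all? (λ i → nonempty? (lookup B i))
        ×-dec all? (λ i → all? (λ j →
                ¬? (i ≟ j) →-dec ¬? (nonempty? (lookup B i ∩ lookup B j))))
        ×-dec ≡-dec Bool._≟_ (⋃ (toList B)) ⊤)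

contains123? : {n k : ℕ} (B : Vec (Subset n) k) → Dec (Contains123 B)
contains123? B =
  any? λ i₁ → any? λ i₂ → any? λ i₃ → i₁ <? i₂ ×-dec i₂ <? i₃ ×-dec
    (any? λ b₁ → any? λ b₂ → any? λ b₃ →
      b₁ ∈? lookup B i₁ ×-dec b₂ ∈? lookup B i₂ ×-dec b₃ ∈? lookup B i₃ ×-dec
      b₁ <? b₂ ×-dec b₂ <? b₃)

avoids123? : {n k : ℕ} (B : Vec (Subset n) k) → Dec (Avoids123 B)
avoids123? B = ¬? (contains123? B)

allVecs : {A : Set} → List A → (n : ℕ) → List (Vec A n)
allVecs xs zero    = [] ∷ []
allVecs xs (suc n) = cartesianProductWith _∷_ xs (allVecs xs n)

allSubsets : (n : ℕ) → List (Subset n)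
allSubsets = allVecs (outside ∷ inside ∷ [])

avoiders123 : (n k : ℕ) → List (Vec (Subset n) k)
avoiders123 n k =
  filter (λ B → isOrderedPartition? B ×-dec avoids123? B)
         (allVecs (allSubsets n) k)

op123 : ℕ → ℕ → ℕ
op123 n k = length (avoiders123 n k)

-- The list avoiders123 n k contains every 123-avoiding ordered partition of [n]
-- into k blocks exactly once and nothing else, so its length is their number.

allVecs-complete : {A : Set} {xs : List A} → (∀ x → x ∈ˡ xs) →
                   ∀ {n} (v : Vec A n) → v ∈ˡ allVecs xs n
allVecs-complete c []      = here refl
allVecs-complete c (x ∷ v) = ∈-cartesianProductWith⁺ _∷_ (c x) (allVecs-complete c v)

allVecs-unique : {A : Set} {xs : List A} → Unique xs → ∀ n → Unique (allVecs xs n)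
allVecs-unique u zero    = [] ∷ []
allVecs-unique u (suc n) = Unique.cartesianProductWith⁺ _∷_ ∷-injective u (allVecs-unique u n)

allSubsets-complete : ∀ {n} (p : Subset n) → p ∈ˡ allSubsets n
allSubsets-complete = allVecs-complete λ { false → here refl ; true → there (here refl) }

allSubsets-unique : ∀ n → Unique (allSubsets n)
allSubsets-unique = allVecs-unique (((λ ()) ∷ []) ∷ [] ∷ [])

∈-avoiders123 : ∀ {n k} (B : Vec (Subset n) k) →
                B ∈ˡ avoiders123 n k ⇔ (IsOrderedPartition B × Avoids123 B)
∈-avoiders123 {n} {k} B = mk⇔
  (λ m → proj₂ (∈-filter⁻ P? {xs = allVecs (allSubsets n) k} m))
  (∈-filter⁺ P? (allVecs-complete allSubsets-complete B))
  where
  P? : (C : Vec (Subset n) k) → Dec (IsOrderedPartition C × Avoids123 C)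
  P? C = isOrderedPartition? C ×-dec avoids123? C

avoiders123-unique : ∀ n k → Unique (avoiders123 n k)
avoiders123-unique n k =
  Unique.filter⁺ (λ B → isOrderedPartition? B ×-dec avoids123? B)
                 (allVecs-unique (allSubsets-unique n) k)

{-# OPTIONS --safe #-}
-- Cut a block p of a 123-avoiding partition in two and put the part with the
-- smaller elements second.  Elements of the two new blocks then only form
-- descents, so no new 123 arises.  If n > k c, every partition of [n] into k
-- blocks has a block with more than c elements, which can be cut in c ways;
-- conversely a partition into k + 1 blocks together with the index (one of k) of
-- the cut block determines the original partition and the cut.  Hence
-- c · op(n,k) ≤ k · op(n,k+1), and the theorem is the case k = 3, c = 4.
module Submission where

open import Defs
open import Data.Fin.Base as Fin using (Fin; zero; suc; toℕ; pinch)
open import Data.Fin.Properties as Fin using (injective⇒≤; toℕ<n; toℕ-injective)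
open import Data.Empty using () renaming (⊥ to ⊥ᵗ)
open import Data.Fin.Subset using (Subset; Empty; _∈_; _∪_; _∩_; ⋃; ⊤; ⊥; ∣_∣; Nonempty; inside; outside)
open import Data.Fin.Subset.Properties using (∪-assoc; ∪-identityʳ; x∈p∩q⁺; x∈p∩q⁻; nonempty?; Empty-unique; ∣⊥∣≡0; ∣⊤∣≡n; ∉⊥; ∈⊤)
open import Data.List.Base as List using (List; []; _∷_; length; map; cartesianProduct; allFin)
open import Data.List.Membership.Propositional using () renaming (_∈_ to _∈ˡ_)
open import Data.List.Membership.Propositional.Properties using (∈-lookup; ∈-allFin; ∈-cartesianProduct⁺; ∈-cartesianProduct⁻)
open import Data.List.Properties using (length-++; length-map; length-tabulate)
import Data.List.Relation.Unary.All as All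
open import Data.List.Relation.Unary.AllPairs using (_∷_)
open import Data.List.Relation.Unary.Any using (index)
open import Data.List.Relation.Unary.Any.Properties using (lookup-index)
open import Data.List.Relation.Unary.Unique.Propositional using (Unique)
import Data.List.Relation.Unary.Unique.Propositional.Properties as Unique
open import Data.Nat.Base using (ℕ; zero; suc; _+_; _*_; _≤_; _<_; _≥_; _>_; z≤n; s≤s; z<s)
open import Data.Nat.Properties
open import Data.Product.Base using (∃-syntax; _×_; _,_; proj₁; proj₂)
open import Data.Vec.Base using (Vec; []; _∷_; lookup; toList; here; there)
open import Data.Vec.Properties using (∷-injective)
open import Function.Base using (_∘_)
open import Function.Bundles using (Equivalence)
open import Relation.Binary.Definitions using (tri<; tri≈; tri>)
open import Relation.Binary.PropositionalEquality using (_≡_; _≢_; refl; sym; trans; cong; cong₂; subst; subst₂)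
open import Relation.Nullary.Decidable using (yes; no)
open import Relation.Nullary.Negation using (contradiction)

private
  variable
    X Y : Set
    n k j j′ c : ℕ

-- Comparing lengths of lists.

length-cartesianProduct : (xs : List X) (ys : List Y) →
                          length (cartesianProduct xs ys) ≡ length xs * length ys
length-cartesianProduct []       ys = refl
length-cartesianProduct (x ∷ xs) ys =
  trans (length-++ (map (x ,_) ys))
        (cong₂ _+_ (length-map (x ,_) ys) (length-cartesianProduct xs ys))

Unique⇒lookup-injective : {xs : List X} → Unique xs →
                          ∀ {i j} → List.lookup xs i ≡ List.lookup xs j → i ≡ j
Unique⇒lookup-injective (_  ∷ _) {zero}  {zero}  _  = refl
Unique⇒lookup-injective (x∉ ∷ _) {zero}  {suc j} eq = contradiction eq (All.lookup x∉ (∈-lookup j))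
Unique⇒lookup-injective (x∉ ∷ _) {suc i} {zero}  eq = contradiction (sym eq) (All.lookup x∉ (∈-lookup i))
Unique⇒lookup-injective (_  ∷ u) {suc i} {suc j} eq = cong suc (Unique⇒lookup-injective u eq)

-- Choosing a partner for each position of `xs` gives an injection into the positions of `ys`: a
-- shared partner forces equal entries, and `Unique xs` then forces equal positions. A relation
-- replaces a function because a partner may depend on the proof of membership; below, the block to
-- cut is found from that proof.
length-≤-by-matching : (R : X → Y → Set) {xs : List X} {ys : List Y} → Unique xs →
                       (∀ {x} → x ∈ˡ xs → ∃[ y ] (y ∈ˡ ys × R x y)) →
                       (∀ {x x′ y} → R x y → R x′ y → x ≡ x′) →
                       length xs ≤ length ys
length-≤-by-matching {X} {Y} R {xs} {ys} u match R-injective = injective⇒≤ {f = f} f-injective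
  where
  partner : ∀ i → ∃[ y ] (y ∈ˡ ys × R (List.lookup xs i) y)
  partner i = match (∈-lookup i)

  f : Fin (length xs) → Fin (length ys)
  f i = index (proj₁ (proj₂ (partner i)))

  related : ∀ i → R (List.lookup xs i) (List.lookup ys (f i))
  related i with y , y∈ys , r ← partner i = subst (R _) (lookup-index y∈ys) r

  f-injective : ∀ {i j} → f i ≡ f j → i ≡ j
  f-injective {i} {j} eq = Unique⇒lookup-injective u
    (R-injective (related i) (subst (R _ ∘ List.lookup ys) (sym eq) (related j)))

-- Splitting a subset by size of elements.

smallest : ℕ → Subset n → Subset n
smallest zero    p             = ⊥
smallest (suc j) []            = []
smallest (suc j) (inside ∷ p)  = inside  ∷ smallest j p
smallest (suc j) (outside ∷ p) = outside ∷ smallest (suc j) p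

others : ℕ → Subset n → Subset n
others zero    p             = p
others (suc j) []            = []
others (suc j) (inside ∷ p)  = outside ∷ others j p
others (suc j) (outside ∷ p) = outside ∷ others (suc j) p

smallest-⊆ : ∀ j (p : Subset n) {x} → x ∈ smallest j p → x ∈ p
smallest-⊆ zero    p             x∈         = contradiction x∈ ∉⊥
smallest-⊆ (suc j) (inside ∷ p)  here       = here
smallest-⊆ (suc j) (inside ∷ p)  (there x∈) = there (smallest-⊆ j p x∈)
smallest-⊆ (suc j) (outside ∷ p) (there x∈) = there (smallest-⊆ (suc j) p x∈)

others-⊆ : ∀ j (p : Subset n) {x} → x ∈ others j p → x ∈ p
others-⊆ zero    p             x∈         = x∈
others-⊆ (suc j) (inside ∷ p)  (there x∈) = there (others-⊆ j p x∈)
others-⊆ (suc j) (outside ∷ p) (there x∈) = there (others-⊆ (suc j) p x∈)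

others∪smallest : ∀ j (p : Subset n) → others j p ∪ smallest j p ≡ p
others∪smallest zero    p             = ∪-identityʳ p
others∪smallest (suc j) []            = refl
others∪smallest (suc j) (inside ∷ p)  = cong (inside ∷_) (others∪smallest j p)
others∪smallest (suc j) (outside ∷ p) = cong (outside ∷_) (others∪smallest (suc j) p)

-- The order of `Fin n` is the position in the vector, and `smallest` takes the first `j` `inside`
-- entries, leaving only later ones to `others`.
smallest<others : ∀ j (p : Subset n) {x y} → x ∈ smallest j p → y ∈ others j p → x Fin.< y
smallest<others zero    p             x∈         y∈         = contradiction x∈ ∉⊥
smallest<others (suc j) (inside ∷ p)  here       (there y∈) = z<s
smallest<others (suc j) (inside ∷ p)  (there x∈) (there y∈) = s≤s (smallest<others j p x∈ y∈)
smallest<others (suc j) (outside ∷ p) (there x∈) (there y∈) = s≤s (smallest<others (suc j) p x∈ y∈)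

∣smallest∣ : ∀ j (p : Subset n) → j ≤ ∣ p ∣ → ∣ smallest j p ∣ ≡ j
∣smallest∣ {n} zero p _ = ∣⊥∣≡0 n
∣smallest∣ (suc j) (inside ∷ p)  (s≤s j≤p) = cong suc (∣smallest∣ j p j≤p)
∣smallest∣ (suc j) (outside ∷ p) j≤p       = ∣smallest∣ (suc j) p j≤p

0<∣others∣ : ∀ j (p : Subset n) → j < ∣ p ∣ → 0 < ∣ others j p ∣
0<∣others∣ zero    p             j<p       = j<p
0<∣others∣ (suc j) (inside ∷ p)  (s≤s j<p) = 0<∣others∣ j p j<p
0<∣others∣ (suc j) (outside ∷ p) j<p       = 0<∣others∣ (suc j) p j<p

0<∣p∣⇒Nonempty : (p : Subset n) → 0 < ∣ p ∣ → Nonempty p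
0<∣p∣⇒Nonempty {n} p 0<p with nonempty? p
... | yes ne = ne
... | no  em = contradiction (trans (cong ∣_∣ (Empty-unique em)) (∣⊥∣≡0 n)) (>⇒≢ 0<p)

∣p∪q∣≤∣p∣+∣q∣ : (p q : Subset n) → ∣ p ∪ q ∣ ≤ ∣ p ∣ + ∣ q ∣
∣p∪q∣≤∣p∣+∣q∣ []            []            = z≤n
∣p∪q∣≤∣p∣+∣q∣ (inside ∷ p)  (inside ∷ q)  = s≤s (≤-trans (∣p∪q∣≤∣p∣+∣q∣ p q) (+-monoʳ-≤ ∣ p ∣ (n≤1+n ∣ q ∣)))
∣p∪q∣≤∣p∣+∣q∣ (inside ∷ p)  (outside ∷ q) = s≤s (∣p∪q∣≤∣p∣+∣q∣ p q)
∣p∪q∣≤∣p∣+∣q∣ (outside ∷ p) (inside ∷ q)  =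
  subst (suc ∣ p ∪ q ∣ ≤_) (sym (+-suc ∣ p ∣ ∣ q ∣)) (s≤s (∣p∪q∣≤∣p∣+∣q∣ p q))
∣p∪q∣≤∣p∣+∣q∣ (outside ∷ p) (outside ∷ q) = ∣p∪q∣≤∣p∣+∣q∣ p q

-- Cutting a block of a partition.

cut : Vec (Subset n) k → Fin k → ℕ → Vec (Subset n) (suc k)
cut (p ∷ B) zero    j = others j p ∷ smallest j p ∷ B
cut (p ∷ B) (suc i) j = p ∷ cut B i j

-- The cut block is recovered as the union of its two parts, and the cut position as the size of the
-- second part. The bounds on `j` and `j′` ensure that this part really has that size.
cut-injective : (B B′ : Vec (Subset n) k) (i : Fin k) → cut B i j ≡ cut B′ i j′ →
                j ≤ ∣ lookup B i ∣ → j′ ≤ ∣ lookup B′ i ∣ → B ≡ B′ × j ≡ j′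
cut-injective {j = j} {j′} (p ∷ B) (p′ ∷ B′) zero eq j≤ j′≤
  with o≡ , eq′ ← ∷-injective eq
  with s≡ , refl ← ∷-injective eq′ =
    cong (_∷ B) (trans (sym (others∪smallest j p)) (trans (cong₂ _∪_ o≡ s≡) (others∪smallest j′ p′))) ,
    trans (sym (∣smallest∣ j p j≤)) (trans (cong ∣_∣ s≡) (∣smallest∣ j′ p′ j′≤))
cut-injective (p ∷ B) (p′ ∷ B′) (suc i) eq j≤ j′≤
  with refl , eq′ ← ∷-injective eq
  with refl , j≡j′ ← cut-injective B B′ i eq′ j≤ j′≤ = refl , j≡j′

⋃-cut : (B : Vec (Subset n) k) (i : Fin k) (j : ℕ) → ⋃ (toList (cut B i j)) ≡ ⋃ (toList B)
⋃-cut (p ∷ B) zero    j = trans (sym (∪-assoc (others j p) (smallest j p) (⋃ (toList B))))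
                                (cong (_∪ ⋃ (toList B)) (others∪smallest j p))
⋃-cut (p ∷ B) (suc i) j = cong (p ∪_) (⋃-cut B i j)

-- `pinch i` merges the indices of the two new blocks, so it sends each block after the cut to the
-- block it came from.
cut-⊆ : (B : Vec (Subset n) k) (i : Fin k) (j : ℕ) (a : Fin (suc k)) {x : Fin n} →
        x ∈ lookup (cut B i j) a → x ∈ lookup B (pinch i a)
cut-⊆ (p ∷ B) zero    j zero          x∈ = others-⊆ j p x∈
cut-⊆ (p ∷ B) zero    j (suc zero)    x∈ = smallest-⊆ j p x∈
cut-⊆ (p ∷ B) zero    j (suc (suc a)) x∈ = x∈
cut-⊆ (p ∷ B) (suc i) j zero          x∈ = x∈
cut-⊆ (p ∷ B) (suc i) j (suc a)       x∈ = cut-⊆ B i j a x∈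

-- `pinch i` preserves `<` on indices except that it merges the two new blocks. For these, every
-- element of the second lies below every element of the first, against `x Fin.≤ y`. The case
-- `x = y` serves disjointness, the case `x < y` avoidance.
pinch-<-cut : (B : Vec (Subset n) k) (i : Fin k) (j : ℕ) {a b : Fin (suc k)} {x y : Fin n} →
              x ∈ lookup (cut B i j) a → y ∈ lookup (cut B i j) b →
              x Fin.≤ y → a Fin.< b → pinch i a Fin.< pinch i b
pinch-<-cut (p ∷ B) zero    j {zero}  {suc zero}    x∈ y∈ x≤y a<b = contradiction x≤y (<⇒≱ (smallest<others j p y∈ x∈))
pinch-<-cut (p ∷ B) zero    j {zero}  {suc (suc b)} x∈ y∈ x≤y a<b = z<s
pinch-<-cut (p ∷ B) zero    j {suc a} {suc b}       x∈ y∈ x≤y (s≤s a<b) = a<b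
pinch-<-cut (p ∷ B) (suc i) j {zero}  {suc b}       x∈ y∈ x≤y a<b = z<s
pinch-<-cut (p ∷ B) (suc i) j {suc a} {suc b}       x∈ y∈ x≤y (s≤s a<b) = s≤s (pinch-<-cut B i j x∈ y∈ x≤y a<b)

cut-nonempty : (B : Vec (Subset n) k) (i : Fin k) → (∀ a → Nonempty (lookup B a)) →
               0 < j → j < ∣ lookup B i ∣ → ∀ a → Nonempty (lookup (cut B i j) a)
cut-nonempty {j = j} (p ∷ B) zero ne 0<j j<p zero = 0<∣p∣⇒Nonempty (others j p) (0<∣others∣ j p j<p)
cut-nonempty {j = j} (p ∷ B) zero ne 0<j j<p (suc zero) =
  0<∣p∣⇒Nonempty (smallest j p) (subst (0 <_) (sym (∣smallest∣ j p (<⇒≤ j<p))) 0<j)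
cut-nonempty (p ∷ B) zero    ne 0<j j<p (suc (suc a)) = ne (suc a)
cut-nonempty (p ∷ B) (suc i) ne 0<j j<p zero          = ne zero
cut-nonempty (p ∷ B) (suc i) ne 0<j j<p (suc a)       = cut-nonempty B i (ne ∘ suc) 0<j j<p a

cut-isOrderedPartition : {B : Vec (Subset n) k} (i : Fin k) → IsOrderedPartition B →
                         0 < j → j < ∣ lookup B i ∣ → IsOrderedPartition (cut B i j)
cut-isOrderedPartition {n} {k} {j} {B} i (isOrderedPartition ne dis cov) 0<j j<∣Bᵢ∣ =
  isOrderedPartition (cut-nonempty B i ne 0<j j<∣Bᵢ∣) disjoint (trans (⋃-cut B i j) cov)
  where
  C = cut B i j

  not-in-two : ∀ {a b x} → a Fin.< b → x ∈ lookup C a → x ∈ lookup C b → ⊥ᵗ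
  -- With `y = x`, the blocks that `a` and `b` come from have distinct indices, yet both contain
  -- `x`.
  not-in-two a<b x∈a x∈b =
    dis _ _ (Fin.<⇒≢ (pinch-<-cut B i j x∈a x∈b ≤-refl a<b))
        (_ , x∈p∩q⁺ (cut-⊆ B i j _ x∈a , cut-⊆ B i j _ x∈b))

  disjoint : ∀ a b → a ≢ b → Empty (lookup C a ∩ lookup C b)
  disjoint a b a≢b (x , x∈) with x∈a , x∈b ← x∈p∩q⁻ (lookup C a) (lookup C b) x∈ | Fin.<-cmp a b
  ... | tri< a<b _ _ = not-in-two a<b x∈a x∈b
  ... | tri≈ _ a≡b _ = a≢b a≡b
  ... | tri> _ _ b<a = not-in-two b<a x∈b x∈a

-- A 123 after the cut pulls back along `pinch i`, with the same three elements, to a 123 in `B`.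
cut-avoids123 : {B : Vec (Subset n) k} (i : Fin k) → Avoids123 B → Avoids123 (cut B i j)
cut-avoids123 {j = j} {B} i avoids
  (a₁ , a₂ , a₃ , a₁<a₂ , a₂<a₃ , b₁ , b₂ , b₃ , ∈₁ , ∈₂ , ∈₃ , b₁<b₂ , b₂<b₃) =
  avoids (pinch i a₁ , pinch i a₂ , pinch i a₃ ,
          pinch-<-cut B i j ∈₁ ∈₂ (<⇒≤ b₁<b₂) a₁<a₂ ,
          pinch-<-cut B i j ∈₂ ∈₃ (<⇒≤ b₂<b₃) a₂<a₃ ,
          b₁ , b₂ , b₃ , cut-⊆ B i j a₁ ∈₁ , cut-⊆ B i j a₂ ∈₂ , cut-⊆ B i j a₃ ∈₃ , b₁<b₂ , b₂<b₃)

-- Large blocks and the counting inequality.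

∣⋃∣≤ : (B : Vec (Subset n) k) → (∀ i → ∣ lookup B i ∣ ≤ c) → ∣ ⋃ (toList B) ∣ ≤ k * c
∣⋃∣≤ {n} []      _  = ≤-reflexive (∣⊥∣≡0 n)
∣⋃∣≤     (p ∷ B) ≤c = ≤-trans (∣p∪q∣≤∣p∣+∣q∣ p (⋃ (toList B)))
                              (+-mono-≤ (≤c zero) (∣⋃∣≤ B (≤c ∘ suc)))

-- Pigeonhole: blocks of at most `c` elements each would cover at most `k * c` of the `n` points.
large-block : {B : Vec (Subset n) k} → IsOrderedPartition B → k * c < n →
              ∃[ i ] c < ∣ lookup B i ∣
large-block {n} {k} {c} {B} part kc<n with Fin.any? (λ i → c <? ∣ lookup B i ∣)
... | yes large = large
... | no ¬large = contradiction (∣⋃∣≤ B (λ i → ≮⇒≥ (λ c< → ¬large (i , c<))))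
                    (<⇒≱ (subst (k * c <_) (sym (trans (cong ∣_∣ covering) (∣⊤∣≡n n))) kc<n))
  where open IsOrderedPartition part

op123-cut : ∀ n k c → k * c < n → c * op123 n k ≤ k * op123 n (suc k)
op123-cut n k c kc<n = subst₂ _≤_ (lengths c k) (lengths k (suc k))
  (length-≤-by-matching CutOf
    (Unique.cartesianProduct⁺ (Unique.allFin⁺ c) (avoiders123-unique n k)) match CutOf-injective)
  where
  lengths : ∀ m l → length (cartesianProduct (allFin m) (avoiders123 n l)) ≡ m * op123 n l
  lengths m l = trans (length-cartesianProduct (allFin m) (avoiders123 n l))
                      (cong (_* op123 n l) (length-tabulate {n = m} (λ i → i)))

  CutOf : Fin c × Vec (Subset n) k → Fin k × Vec (Subset n) (suc k) → Set
  -- The second part gets between 1 and `c` elements, so a block with more than `c` leaves both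
  -- parts nonempty. The size bound is kept in the relation because `cut-injective` needs it.
  CutOf (j , B) (i , C) = cut B i (suc (toℕ j)) ≡ C × c < ∣ lookup B i ∣

  CutOf-injective : ∀ {x x′ y} → CutOf x y → CutOf x′ y → x ≡ x′
  CutOf-injective {j , B} {j′ , B′} {i , _} (refl , c<) (eq , c<′)
    with refl , j≡ ← cut-injective B B′ i (sym eq) (≤-trans (toℕ<n j) (<⇒≤ c<)) (≤-trans (toℕ<n j′) (<⇒≤ c<′))
    = cong (_, B) (toℕ-injective (suc-injective j≡))

  match : ∀ {x} → x ∈ˡ cartesianProduct (allFin c) (avoiders123 n k) →
          ∃[ y ] (y ∈ˡ cartesianProduct (allFin k) (avoiders123 n (suc k)) × CutOf x y)
  match {j , B} x∈
    with part , avoids ← Equivalence.to (∈-avoiders123 B) (proj₂ (∈-cartesianProduct⁻ (allFin c) _ x∈))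
    with i , c< ← large-block part kc<n =
      (i , cut B i (suc (toℕ j))) ,
      ∈-cartesianProduct⁺ (∈-allFin i)
        (Equivalence.from (∈-avoiders123 _)
          (cut-isOrderedPartition i part z<s (≤-<-trans (toℕ<n j) c<) , cut-avoids123 {B = B} i avoids)) ,
      refl , c<

0<op123[n,1] : 0 < n → 0 < op123 n 1
0<op123[n,1] {n@(suc _)} _ = ∈⇒0<length (Equivalence.from (∈-avoiders123 (⊤ ∷ [])) (part , avoids))
  where
  ∈⇒0<length : {x : X} {xs : List X} → x ∈ˡ xs → 0 < length xs
  ∈⇒0<length {xs = _ ∷ _} _ = z<s

  part : IsOrderedPartition (⊤ {n} ∷ [])
  part = isOrderedPartition (λ { zero → zero , ∈⊤ }) (λ { zero zero 0≢0 → contradiction refl 0≢0 })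
           (∪-identityʳ ⊤)

  avoids : Avoids123 (⊤ {n} ∷ [])
  avoids (zero , zero , _ , () , _)

-- Induction from the one-block partition, adding a block by `op123-cut` with `c = 1`. Positivity is
-- what makes the final inequality strict.
0<op123 : ∀ k → k < n → 0 < op123 n (suc k)
0<op123     zero    0<n = 0<op123[n,1] 0<n
0<op123 {n} (suc k) k<n = m*n>0⇒n>0 (suc k)
  (≤-trans (subst (0 <_) (sym (*-identityˡ _)) (0<op123 k (<⇒≤ k<n)))
           (op123-cut n (suc k) 1 (subst (_< n) (sym (*-identityʳ (suc k))) k<n)))
  where
  m*n>0⇒n>0 : ∀ m {n} → 0 < m * n → 0 < n
  m*n>0⇒n>0 m {zero}  0< = contradiction (*-zeroʳ m) (>⇒≢ 0<)
  m*n>0⇒n>0 m {suc n} 0< = z<s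

-- Write `m` for `suc k`. Taking `c = m + 1` in `op123-cut` gives m · op(n,m) < (m+1) · op(n,m) ≤ m
-- · op(n,m+1), strict since op(n,m) is positive; then `m` cancels.
op123-increasing : ∀ n k → suc k * suc (suc k) < n → op123 n (suc k) < op123 n (suc (suc k))
op123-increasing n k large = *-cancelˡ-< (suc k) _ _
  (<-≤-trans (+-monoˡ-< (suc k * op123 n (suc k)) (0<op123 k (≤-<-trans (m≤n⇒m≤n*o (suc (suc k)) (n≤1+n k)) large)))
             (op123-cut n (suc k) (suc (suc k)) large))

theorem9 : ∃[ n₀ ] (∀ (n : ℕ) → n ≥ n₀ → op123 n 4 > op123 n 3)
-- The size condition for `k = 2` is 3 · 4 < n.
theorem9 = 13 , λ n n≥13 → op123-increasing n 2 n≥13
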